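{- Let $b \ge 2$ be an integer. A positive integer $k$ has no comma-successor in base $b$ (or, equally, has no comma-child in base $b$) if and only if the base-$b$ representation of $k$ has the form $$(b-1)\,(b-1)\,\ldots\,(b-1)\,x\,y,$$ consisting of $i \ge 0$ digits equal to $b-1$ followed by the two digits $x$ and $y$, where $1 \le x \le b-2$ and $y = b-1-x$.
   Context: Fix a base $b \ge 2$. A digit is any integer between $0$ and $b-1$. For a positive integer $n$, let $\delta(n)$ denote its leading (most significant, nonzero) base-$b$ digit. For positive integers $k, k'$, we say that $k'$ is a comma-child of $k$ (in base $b$) if $k' - k = d\cdot b + \delta(k')$, where $d = k \bmod b$ is the last base-$b$ digit of $k$. If $k$ has at least one comma-child, the comma-successor of $k$ is its smallest comma-child; otherwise $k$ has no comma-successor. -}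

module Defs where

open import Data.Digit using (Digit; Expansion; fromDigits)
open import Data.Fin.Base using (toℕ)
open import Data.Integer.Base as ℤ using (+_)
open import Data.List.Base using ([]; _∷_; _++_; head; map; replicate; reverse)
open import Data.Maybe.Relation.Unary.Any using (Any)
open import Data.Nat.Base
  using (ℕ; _+_; _*_; _∸_; _%_; _≤_; NonZero; NonTrivial; nonTrivial⇒nonZero)
open import Data.Product.Base using (Σ-syntax; ∃-syntax; _×_)
open import Relation.Binary.PropositionalEquality.Core using (_≡_)

module _ (b : ℕ) .{{b≥2 : NonTrivial b}} where

  -- Digits are listed from the most significant to the least significant
  -- one, without leading zeros; `fromDigits` reads them in the opposite order.
  Represents : Expansion b → ℕ → Set
  Represents ds n = fromDigits (reverse ds) ≡ n × Any (λ c → NonZero (toℕ c)) (head ds)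

  -- The graph of δ: every positive n has exactly one representation, so
  -- exactly one c satisfies this.
  LeadingDigit : ℕ → Digit b → Set
  LeadingDigit n c = ∃[ ds ] Represents (c ∷ ds) n

  lastDigit : ℕ → ℕ
  lastDigit n = (n % b) {{nonTrivial⇒nonZero b}}

  -- k′ - k = d · b + δ(k′), with the subtraction taken in ℤ.
  CommaChild : ℕ → ℕ → Set
  CommaChild k k′ =
    NonZero k′ ×
    Σ[ c ∈ Digit b ] (LeadingDigit k′ c ×
                      + k′ ℤ.- + k ≡ + (lastDigit k * b + toℕ c))

  CommaSuccessor : ℕ → ℕ → Set
  CommaSuccessor k k′ = CommaChild k k′ × (∀ k″ → CommaChild k k″ → k′ ≤ k″)

  -- k is written (b-1) … (b-1) x y. The two subtractions are never
  -- truncated, since 2 ≤ b and x ≤ b - 2.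
  SpecialForm : ℕ → Set
  SpecialForm k =
    Σ[ ds ∈ Expansion b ] Σ[ i ∈ ℕ ] Σ[ x ∈ ℕ ] Σ[ y ∈ ℕ ]
      (Represents ds k ×
       map toℕ ds ≡ replicate i (b ∸ 1) ++ x ∷ y ∷ [] ×
       1 ≤ x × x ≤ b ∸ 2 × y ≡ b ∸ 1 ∸ x)

{-# OPTIONS --safe #-}

-- Put d = k mod b and f = k + d b, so that the comma-children of k are the
-- numbers f + c with 1 ≤ c < b and leading digit c. If m is the leading digit
-- of f, then c = m works unless adding m to f carries into the leading digit.
-- In that case c = m + 1 works when m + 1 < b, and c = 1 is the only candidate
-- when m = b - 1; it fails exactly if f = b^(i+2) - s with 2 ≤ s < b.
-- Reducing mod b then gives d + s = b, hence k is the special number with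
-- x = s - 1 and y = d. Conversely, for a special k one has
-- f = b^(i+2) - b + y, and neither of the possible leading digits b - 1 and 1
-- of f + c is consistent with 1 ≤ x and 1 ≤ y.
module Submission where

open import Defs
open import Data.Digit using (Expansion; fromDigits)
open import Data.Empty using (⊥)
open import Data.Fin.Base using (toℕ; fromℕ<)
open import Data.Fin.Properties using (toℕ<n; toℕ-fromℕ<)
open import Data.Integer.Base as ℤ using (+_)
import Data.Integer.Properties as ℤₚ
open import Data.List.Base using ([]; _∷_; _++_; _∷ʳ_; head; length; map; replicate; reverse)
open import Data.List.Properties
  using (∷-injective; length-reverse; map-++; map-replicate; reverse-involutive; unfold-reverse)
open import Data.Maybe.Relation.Unary.Any using (Any; just)
open import Data.Nat.Base
open import Data.Nat.Divisibility using (_∣_; divides; ∣m+n∣m⇒∣n; m∣m*n; n∣m*n)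
open import Data.Nat.DivMod
  using (m%n<n; m≡m%n+[m/n]*n; [m+kn]%n≡m%n; m<n⇒m%n≡m; m<n*o⇒m/o<n)
open import Data.Nat.Induction using (<-rec)
open import Data.Nat.Properties
open import Data.Nat.Tactic.RingSolver using (solve-∀)
open import Data.Product.Base using (∃; ∃-syntax; _×_; _,_; proj₂)
open import Data.Sum.Base using (_⊎_; inj₁; inj₂)
open import Function.Base using (_∘_)
open import Function.Bundles using (_⇔_; mk⇔)
open import Relation.Binary.PropositionalEquality
open import Relation.Nullary.Negation.Core using (¬_; contradiction)

-- Strong induction: once all smaller numbers are excluded, a witness would itself be least. This
-- turns the absence of a comma-successor into the absence of any comma-child.
¬∃-least⇒¬∃ : ∀ {p} (P : ℕ → Set p) →
  ¬ (∃[ n ] (P n × (∀ m → P m → n ≤ m))) → ¬ ∃ P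
¬∃-least⇒¬∃ P noLeast (n , pn) = <-rec (λ n → ¬ P n) step n pn
  where
  step : ∀ n → (∀ {m} → m < n → ¬ P m) → ¬ P n
  step n below pn = noLeast (n , pn , λ m pm → ≮⇒≥ λ m<n → below m<n pm)

-- Differences in ℤ of natural numbers

+[m+n]-+m≡+n : ∀ m n → + (m + n) ℤ.- + m ≡ + n
+[m+n]-+m≡+n m n = begin
  + (m + n) ℤ.- + m       ≡⟨ ℤₚ.m-n≡m⊖n (m + n) m ⟩
  (m + n) ℤ.⊖ m           ≡⟨ ℤₚ.⊖-≥ (m≤m+n m n) ⟩
  + (m + n ∸ m)           ≡⟨ cong +_ (m+n∸m≡n m n) ⟩
  + n                     ∎
  where open ≡-Reasoning

+m-+n≡+o⇒m≡n+o : ∀ m n o → + m ℤ.- + n ≡ + o → m ≡ n + o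
+m-+n≡+o⇒m≡n+o m n o eq with ≤-<-connex n m
... | inj₁ n≤m = trans (sym (m+[n∸m]≡n n≤m)) (cong (λ l → n + l) (ℤₚ.+-injective
  (trans (sym (ℤₚ.⊖-≥ n≤m)) (trans (sym (ℤₚ.m-n≡m⊖n m n)) eq))))
... | inj₂ m<n = contradiction
  (trans (sym (ℤₚ.⊖-< m<n)) (trans (sym (ℤₚ.m-n≡m⊖n m n)) eq))
  (negative (m<n⇒0<n∸m m<n))
  where
  negative : ∀ {p} → 0 < p → ℤ.- (+ p) ≢ + o
  negative z<s ()

module _ {b : ℕ} .{{b≥2 : NonTrivial b}} where

  private instance
    b≢0 : NonZero b
    b≢0 = nonTrivial⇒nonZero b

  1<b : 1 < b
  1<b = nonTrivial⇒n>1 b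

  0<b^ : ∀ e → 0 < b ^ e
  0<b^ = m^n>0 b

  b≤b^suc : ∀ e → b ≤ b ^ suc e
  b≤b^suc e = m≤m*n b (b ^ e) {{m^n≢0 b e}}

  -- Values of digit lists

  fromDigits-∷ʳ : ∀ (ds : Expansion b) c →
    fromDigits (ds ∷ʳ c) ≡ fromDigits ds + toℕ c * b ^ length ds
  fromDigits-∷ʳ []       c = solve (toℕ c)
    where
    solve : ∀ c → c + 0 ≡ c * 1
    solve = solve-∀
  fromDigits-∷ʳ (d ∷ ds) c = trans
    (cong (λ n → toℕ d + n * b) (fromDigits-∷ʳ ds c))
    (solve (toℕ d) (fromDigits ds) (toℕ c) (b ^ length ds) b)
    where
    solve : ∀ d F c L b → d + (F + c * L) * b ≡ d + F * b + c * (b * L)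
    solve = solve-∀

  fromDigits-reverse-∷ : ∀ c (ds : Expansion b) →
    fromDigits (reverse (c ∷ ds)) ≡ fromDigits (reverse ds) + toℕ c * b ^ length ds
  fromDigits-reverse-∷ c ds = begin
    fromDigits (reverse (c ∷ ds))
      ≡⟨ cong fromDigits (unfold-reverse c ds) ⟩
    fromDigits (reverse ds ∷ʳ c)
      ≡⟨ fromDigits-∷ʳ (reverse ds) c ⟩
    fromDigits (reverse ds) + toℕ c * b ^ length (reverse ds)
      ≡⟨ cong (λ l → fromDigits (reverse ds) + toℕ c * b ^ l) (length-reverse ds) ⟩
    fromDigits (reverse ds) + toℕ c * b ^ length ds
      ∎
    where open ≡-Reasoning

  fromDigits<b^length : ∀ (ds : Expansion b) → fromDigits ds < b ^ length ds
  fromDigits<b^length []       = z<s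
  fromDigits<b^length (d ∷ ds) = begin-strict
    toℕ d + fromDigits ds * b  <⟨ +-monoˡ-< _ (toℕ<n d) ⟩
    suc (fromDigits ds) * b    ≤⟨ *-monoˡ-≤ b (fromDigits<b^length ds) ⟩
    b ^ length ds * b          ≡⟨ *-comm _ b ⟩
    b * b ^ length ds          ∎
    where open ≤-Reasoning

  -- Zeros in the top places are allowed, because the part of a number below its leading digit has
  -- to fill exactly `e` places. Digits are split off from the least significant end.
  paddedDigits : ∀ e r → r < b ^ e →
    ∃[ ds ] (length ds ≡ e × fromDigits {b} ds ≡ r)
  paddedDigits zero    zero    _ = [] , refl , refl
  paddedDigits zero    (suc r) (s≤s ())
  paddedDigits (suc e) r       r<b^1+e
    with paddedDigits e (r / b) (m<n*o⇒m/o<n (subst (r <_) (*-comm b (b ^ e)) r<b^1+e))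
  ... | ds , len , val = fromℕ< (m%n<n r b) ∷ ds , cong suc len , (begin
    toℕ (fromℕ< (m%n<n r b)) + fromDigits ds * b
      ≡⟨ cong₂ (λ d n → d + n * b) (toℕ-fromℕ< (m%n<n r b)) val ⟩
    r % b + r / b * b
      ≡⟨ m≡m%n+[m/n]*n r b ⟨
    r ∎)
    where open ≡-Reasoning

  -- Leading digits as membership in the intervals from c b^e to (c + 1) b^e

  Leads : ℕ → ℕ → Set
  Leads n c = ∃[ e ] (c * b ^ e ≤ n × n < suc c * b ^ e)

  -- The exponent is the number of digits after the first; together they contribute less than one
  -- unit of the leading place. `Leads` alone does not force `c` to be a nonzero digit, so
  -- `1 ≤ toℕ c` travels beside it.
  LeadingDigit⇒Leads : ∀ {n} c → LeadingDigit b n c → 1 ≤ toℕ c × Leads n (toℕ c)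
  LeadingDigit⇒Leads c (ds , refl , just c≢0) =
    >-nonZero⁻¹ (toℕ c) {{c≢0}} ,
    length ds ,
    ≤-trans (m≤n+m _ _) (≤-reflexive (sym (fromDigits-reverse-∷ c ds))) ,
    (begin-strict
      fromDigits (reverse (c ∷ ds))
        ≡⟨ fromDigits-reverse-∷ c ds ⟩
      fromDigits (reverse ds) + toℕ c * b ^ length ds
        <⟨ +-monoˡ-< _ (fromDigits<b^length (reverse ds)) ⟩
      b ^ length (reverse ds) + toℕ c * b ^ length ds
        ≡⟨ cong (λ l → b ^ l + toℕ c * b ^ length ds) (length-reverse ds) ⟩
      suc (toℕ c) * b ^ length ds ∎)
    where open ≤-Reasoning

  -- The remainder n - c b^e is below b^e, so it can be written with exactly `e` padded digits after
  -- `c`.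
  Leads⇒LeadingDigit : ∀ {n} c → 1 ≤ toℕ c → Leads n (toℕ c) → LeadingDigit b n c
  Leads⇒LeadingDigit {n} c 1≤c (e , lo , hi)
    with m≤n⇒∃[o]m+o≡n lo
  ... | r , cb^e+r≡n
    with paddedDigits e r (+-cancelʳ-< (toℕ c * b ^ e) r (b ^ e)
           (subst (_< suc (toℕ c) * b ^ e) (trans (sym cb^e+r≡n) (+-comm _ r)) hi))
  ... | ds , refl , refl = reverse ds , (begin
    fromDigits (reverse (c ∷ reverse ds))
      ≡⟨ fromDigits-reverse-∷ c (reverse ds) ⟩
    fromDigits (reverse (reverse ds)) + toℕ c * b ^ length (reverse ds)
      ≡⟨ cong₂ (λ es l → fromDigits es + toℕ c * b ^ l) (reverse-involutive ds) (length-reverse ds) ⟩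
    fromDigits ds + toℕ c * b ^ length ds
      ≡⟨ +-comm (fromDigits ds) _ ⟩
    toℕ c * b ^ length ds + fromDigits ds
      ≡⟨ cb^e+r≡n ⟩
    n ∎) , just (>-nonZero 1≤c)
    where open ≡-Reasoning

  Leads-multiple : ∀ c e → Leads (c * b ^ e) c
  Leads-multiple c e = e , ≤-refl , +-monoˡ-< (c * b ^ e) (0<b^ e)

  -- Induction on n: the digit m persists until n + 1 reaches (m + 1) b^e. There it becomes m + 1,
  -- or, if m + 1 = b, it becomes 1 at the next exponent.
  Leads-exists : ∀ n .{{_ : NonZero n}} → ∃[ m ] (1 ≤ m × m < b × Leads n m)
  Leads-exists 1 = 1 , ≤-refl , 1<b , Leads-multiple 1 0
  Leads-exists (suc n@(suc _)) with Leads-exists n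
  ... | m , 1≤m , m<b , e , lo , hi with m≤n⇒m<n∨m≡n hi
  ... | inj₁ below = m , 1≤m , m<b , e , m≤n⇒m≤1+n lo , below
  ... | inj₂ 1+n≡ with m≤n⇒m<n∨m≡n m<b
  ... | inj₁ 1+m<b = suc m , s≤s z≤n , 1+m<b ,
    subst (λ l → Leads l (suc m)) (sym 1+n≡) (Leads-multiple (suc m) e)
  ... | inj₂ 1+m≡b = 1 , ≤-refl , 1<b , subst (λ l → Leads l 1)
    (sym (trans 1+n≡ (trans (cong (_* b ^ e) 1+m≡b) (sym (*-identityˡ (b ^ suc e))))))
    (Leads-multiple 1 (suc e))

  -- If e < e′, then n < (c + 1) b^e ≤ b^(e+1) ≤ b^e′ ≤ n. Applied in both directions, this makes
  -- the exponents of two leading digits of n agree.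
  Leads-exponent-≤ : ∀ {n c c′ e e′} → c < b → 1 ≤ c′ →
    n < suc c * b ^ e → c′ * b ^ e′ ≤ n → e′ ≤ e
  Leads-exponent-≤ {n} {c} {c′} {e} {e′} c<b 1≤c′ hi lo′ = ≮⇒≥ λ e<e′ →
    <-irrefl refl (begin-strict
      n               <⟨ hi ⟩
      suc c * b ^ e   ≤⟨ *-monoˡ-≤ (b ^ e) c<b ⟩
      b ^ suc e       ≤⟨ ^-monoʳ-≤ b e<e′ ⟩
      b ^ e′          ≡⟨ *-identityˡ (b ^ e′) ⟨
      1 * b ^ e′      ≤⟨ *-monoˡ-≤ (b ^ e′) 1≤c′ ⟩
      c′ * b ^ e′     ≤⟨ lo′ ⟩
      n               ∎)
    where open ≤-Reasoning

  Leads-unique : ∀ {n c c′} → 1 ≤ c → c < b → 1 ≤ c′ → c′ < b →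
    Leads n c → Leads n c′ → c ≡ c′
  Leads-unique {n} {c} {c′} 1≤c c<b 1≤c′ c′<b (e , lo , hi) (e′ , lo′ , hi′)
    with ≤-antisym (Leads-exponent-≤ {c = c} {c′} {e} {e′} c<b 1≤c′ hi lo′)
                   (Leads-exponent-≤ {c = c′} {c} {e′} {e} c′<b 1≤c hi′ lo)
  ... | refl = ≤-antisym
    (s≤s⁻¹ (*-cancelʳ-< (b ^ e) c (suc c′) (≤-<-trans lo hi′)))
    (s≤s⁻¹ (*-cancelʳ-< (b ^ e) c′ (suc c) (≤-<-trans lo′ hi)))

  -- Digit form and closed form of the special numbers

  suc[b∸1]≡b : suc (b ∸ 1) ≡ b
  suc[b∸1]≡b = m+[n∸m]≡n (<⇒≤ 1<b)

  -- k = b^(i+2) - b² + x b + y, with b² moved to the left.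
  SpecialNumber : ℕ → Set
  SpecialNumber k = ∃[ i ] ∃[ x ] ∃[ y ]
    (1 ≤ x × 1 ≤ y × suc (x + y) ≡ b × k + b * b ≡ b ^ (2 + i) + x * b + y)

  -- Prepending the digit b - 1 adds (b - 1) b^(i+2), which raises b^(i+2) to b^(i+3). The length is
  -- proved alongside, since it fixes the weight of the prepended digit.
  special-value : ∀ i x y (ds : Expansion b) →
    map toℕ ds ≡ replicate i (b ∸ 1) ++ x ∷ y ∷ [] →
    length ds ≡ 2 + i × fromDigits (reverse ds) + b * b ≡ b ^ (2 + i) + x * b + y
  special-value zero    x y (c ∷ d ∷ []) refl = refl , solve (toℕ d) (toℕ c) b
    where
    solve : ∀ d c b → d + (c + 0 * b) * b + b * b ≡ b * (b * 1) + c * b + d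
    solve = solve-∀
  special-value (suc i) x y (c ∷ ds) eq with ∷-injective eq
  ... | c≡b-1 , eq′ with special-value i x y ds eq′
  ... | len , val = cong suc len , (begin
    fromDigits (reverse (c ∷ ds)) + b * b
      ≡⟨ cong (_+ b * b) (fromDigits-reverse-∷ c ds) ⟩
    fromDigits (reverse ds) + toℕ c * b ^ length ds + b * b
      ≡⟨ cong₂ (λ m l → fromDigits (reverse ds) + m * b ^ l + b * b) c≡b-1 len ⟩
    fromDigits (reverse ds) + (b ∸ 1) * b ^ (2 + i) + b * b
      ≡⟨ solve₁ (fromDigits (reverse ds)) ((b ∸ 1) * b ^ (2 + i)) (b * b) ⟩
    (b ∸ 1) * b ^ (2 + i) + (fromDigits (reverse ds) + b * b)
      ≡⟨ cong (λ n → (b ∸ 1) * b ^ (2 + i) + n) val ⟩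
    (b ∸ 1) * b ^ (2 + i) + (b ^ (2 + i) + x * b + y)
      ≡⟨ solve₂ (b ∸ 1) (b ^ (2 + i)) (x * b) y ⟩
    suc (b ∸ 1) * b ^ (2 + i) + x * b + y
      ≡⟨ cong (λ m → m * b ^ (2 + i) + x * b + y) suc[b∸1]≡b ⟩
    b ^ (3 + i) + x * b + y ∎)
    where
    open ≡-Reasoning
    solve₁ : ∀ F A B → F + A + B ≡ A + (F + B)
    solve₁ = solve-∀
    solve₂ : ∀ n B X y → n * B + (B + X + y) ≡ suc n * B + X + y
    solve₂ = solve-∀

  SpecialForm⇒SpecialNumber : ∀ {k} → SpecialForm b k → SpecialNumber k
  SpecialForm⇒SpecialNumber (ds , i , x , y , (refl , _) , eq , 1≤x , x≤b-2 , refl) =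
    i , x , b ∸ 1 ∸ x , 1≤x , m<n⇒0<n∸m x<b-1 ,
    trans (cong suc (m+[n∸m]≡n (<⇒≤ x<b-1))) suc[b∸1]≡b ,
    proj₂ (special-value i x (b ∸ 1 ∸ x) ds eq)
    where
    x<b-1 : x < b ∸ 1
    -- `suc b ∸ 2` reduces to `b ∸ 1`, so `+-∸-assoc` relates `suc (b ∸ 2)` to `b ∸ 1`, using 2 ≤ b.
    x<b-1 = ≤-trans (s≤s x≤b-2) (≤-reflexive (sym (+-∸-assoc 1 1<b)))

  SpecialNumber⇒SpecialForm : ∀ {k} → SpecialNumber k → SpecialForm b k
  SpecialNumber⇒SpecialForm {k} (i , x , y , 1≤x , 1≤y , 1+x+y≡b , val) =
    ds i , i , x , y ,
    -- The constructed digits and k satisfy the same closed form, so cancelling b² identifies their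
    -- values.
    (+-cancelʳ-≡ (b * b) _ _ (trans (proj₂ (special-value i x y (ds i) (map-ds i))) (sym val)) ,
     head≢0 i) ,
    map-ds i , 1≤x , x≤b-2 , y≡
    where
    b-1<b : b ∸ 1 < b
    b-1<b = ≤-reflexive suc[b∸1]≡b
    x<b : x < b
    x<b = subst (x <_) 1+x+y≡b (s≤s (m≤m+n x y))
    y<b : y < b
    y<b = subst (y <_) 1+x+y≡b (s≤s (m≤n+m y x))
    ds : ℕ → Expansion b
    ds i = replicate i (fromℕ< b-1<b) ++ fromℕ< x<b ∷ fromℕ< y<b ∷ []
    map-ds : ∀ i → map toℕ (ds i) ≡ replicate i (b ∸ 1) ++ x ∷ y ∷ []
    map-ds i = trans (map-++ toℕ (replicate i _) _) (cong₂ _++_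
      (trans (map-replicate toℕ i _) (cong (replicate i) (toℕ-fromℕ< b-1<b)))
      (cong₂ (λ u v → u ∷ v ∷ []) (toℕ-fromℕ< x<b) (toℕ-fromℕ< y<b)))
    head≢0 : ∀ i → Any (λ c → NonZero (toℕ c)) (head (ds i))
    head≢0 zero    = just (>-nonZero (subst (0 <_) (sym (toℕ-fromℕ< x<b)) 1≤x))
    head≢0 (suc i) = just (>-nonZero (subst (0 <_) (sym (toℕ-fromℕ< b-1<b)) (m<n⇒0<n∸m 1<b)))
    y≡ : y ≡ b ∸ 1 ∸ x
    y≡ = sym (trans (cong (λ n → n ∸ 1 ∸ x) (sym 1+x+y≡b)) (m+n∸m≡n x y))
    x≤b-2 : x ≤ b ∸ 2
    x≤b-2 = ≤-trans (≤-reflexive (sym (m+n∸n≡m x 1)))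
      (∸-monoˡ-≤ 2 (subst (suc (x + 1) ≤_) 1+x+y≡b (s≤s (+-monoʳ-≤ x 1≤y))))

  -- A comma-child for every number that is not special

  Leads⇒CommaChild : ∀ {k c} → 1 ≤ c → c < b →
    Leads (k + lastDigit b k * b + c) c → ∃ (CommaChild b k)
  Leads⇒CommaChild {k} {c} 1≤c c<b leads =
    k + (lastDigit b k * b + c) ,
    >-nonZero (≤-trans 1≤c (≤-trans (m≤n+m c _) (m≤n+m _ k))) ,
    fromℕ< c<b ,
    Leads⇒LeadingDigit (fromℕ< c<b) (subst (1 ≤_) c≡ 1≤c)
      (subst₂ Leads (+-assoc k _ c) c≡ leads) ,
    trans (+[m+n]-+m≡+n k _) (cong (λ n → + (lastDigit b k * b + n)) c≡)
    where
    c≡ : c ≡ toℕ (fromℕ< c<b)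
    c≡ = sym (toℕ-fromℕ< c<b)

  -- A one-digit k is its own last digit, and k b ≥ b. Hence f has at least two digits.
  b≤k+lastDigit*b : ∀ k .{{_ : NonZero k}} → b ≤ k + lastDigit b k * b
  b≤k+lastDigit*b k with ≤-<-connex b k
  ... | inj₁ b≤k = ≤-trans b≤k (m≤m+n k _)
  ... | inj₂ k<b = begin
    b                    ≤⟨ m≤n*m b k ⟩
    k * b                ≡⟨ cong (_* b) (m<n⇒m%n≡m k<b) ⟨
    lastDigit b k * b    ≤⟨ m≤n+m _ k ⟩
    k + lastDigit b k * b ∎
    where open ≤-Reasoning

  b∣n∧0<n<2b⇒n≡b : ∀ {n} → b ∣ n → 0 < n → n < b + b → n ≡ b
  b∣n∧0<n<2b⇒n≡b (divides zero          refl) () _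
  b∣n∧0<n<2b⇒n≡b (divides 1             refl) _  _ = *-identityˡ b
  b∣n∧0<n<2b⇒n≡b (divides (suc (suc q)) refl) _  n<2b =
    contradiction n<2b (≤⇒≯ (+-monoʳ-≤ b (m≤m+n b (q * b))))

  -- Since k + d b ≡ d modulo b, b divides d + s; both summands are below b, which leaves d + s = b.
  -- Replacing first one factor of b² and then a single b by d + s yields the closed form.
  gap⇒SpecialNumber : ∀ {k s i} → 1 < s → s < b →
    k + lastDigit b k * b + s ≡ b ^ (2 + i) → SpecialNumber k
  gap⇒SpecialNumber {k} {suc x} {i} (s≤s 1≤x) s<b eq =
    i , x , d , 1≤x , 1≤d , trans (+-comm (suc x) d) d+s≡b , (begin
      k + b * b                        ≡⟨ cong (λ n → k + n * b) d+s≡b ⟨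
      k + (d + suc x) * b              ≡⟨ solve₂ k d x b ⟩
      k + d * b + x * b + b            ≡⟨ cong (λ n → k + d * b + x * b + n) d+s≡b ⟨
      k + d * b + x * b + (d + suc x)  ≡⟨ solve₃ (k + d * b) (x * b) d (suc x) ⟩
      k + d * b + suc x + x * b + d    ≡⟨ cong (λ n → n + x * b + d) eq ⟩
      b ^ (2 + i) + x * b + d          ∎)
    where
    open ≡-Reasoning
    d = lastDigit b k
    solve₁ : ∀ d q b s → d + q * b + d * b + s ≡ (q + d) * b + (d + s)
    solve₁ = solve-∀
    solve₂ : ∀ k d x b → k + (d + suc x) * b ≡ k + d * b + x * b + b
    solve₂ = solve-∀
    solve₃ : ∀ f X d s → f + X + (d + s) ≡ f + s + X + d
    solve₃ = solve-∀
    b∣d+s : b ∣ d + suc x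
    b∣d+s = ∣m+n∣m⇒∣n
      (subst (b ∣_) (trans (sym eq) (trans
        (cong (λ n → n + d * b + suc x) (m≡m%n+[m/n]*n k b))
        (solve₁ d (k / b) b (suc x))))
        (m∣m*n (b ^ suc i)))
      (n∣m*n (k / b + d))
    d+s≡b : d + suc x ≡ b
    d+s≡b = b∣n∧0<n<2b⇒n≡b b∣d+s (≤-trans z<s (m≤n+m (suc x) d))
      (+-mono-< (m%n<n k b) s<b)
    1≤d : 1 ≤ d
    -- If d were 0, then s would equal b.
    1≤d = n≢0⇒n>0 λ d≡0 → <⇒≢ s<b (trans (cong (_+ suc x) (sym d≡0)) d+s≡b)

  CommaChild⊎SpecialNumber : ∀ k .{{_ : NonZero k}} → ∃ (CommaChild b k) ⊎ SpecialNumber k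
  CommaChild⊎SpecialNumber k = cases (Leads-exists f {{>-nonZero (≤-trans (<⇒≤ 1<b) b≤f)}})
    where
    f = k + lastDigit b k * b
    b≤f : b ≤ f
    b≤f = b≤k+lastDigit*b k
    cases : ∃[ m ] (1 ≤ m × m < b × Leads f m) → ∃ (CommaChild b k) ⊎ SpecialNumber k
    -- Exponent 0 would give f < m + 1 ≤ b.
    cases (m , 1≤m , m<b , zero , lo , hi) = contradiction
      (≤-trans hi (≤-trans (≤-reflexive (*-identityʳ (suc m))) m<b)) (≤⇒≯ b≤f)
    cases (m , 1≤m , m<b , suc e , lo , hi) with ≤-<-connex (suc m * b ^ suc e) (f + m)
    ... | inj₂ noCarry = inj₁ (Leads⇒CommaChild 1≤m m<b
      (suc e , ≤-trans lo (m≤m+n f m) , noCarry))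
    ... | inj₁ carry with m≤n⇒m<n∨m≡n m<b
    -- The increment m + 1 is less than b ≤ b^(e+1), so it cannot carry f past the interval of the
    -- digit m + 1.
    ... | inj₁ 1+m<b = inj₁ (Leads⇒CommaChild (s≤s z≤n) 1+m<b
      (suc e , ≤-trans carry (+-monoʳ-≤ f (n≤1+n m)) ,
       subst (f + suc m <_) (+-comm (suc m * b ^ suc e) (b ^ suc e))
         (+-mono-< hi (≤-trans 1+m<b (b≤b^suc e)))))
    -- Here m + 1 = b, so the upper end of the interval is the power b^(e+2).
    ... | inj₂ refl with ≤-<-connex (b ^ (2 + e)) (f + 1)
    ... | inj₁ reached = inj₁ (Leads⇒CommaChild {k} ≤-refl 1<b
      (2 + e , ≤-trans (≤-reflexive (*-identityˡ (b ^ (2 + e)))) reached ,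
       +-mono-<-≤ hi (≤-trans (0<b^ (2 + e)) (≤-reflexive (sym (*-identityˡ (b ^ (2 + e))))))))
    ... | inj₂ missed with m≤n⇒∃[o]m+o≡n (<⇒≤ hi)
    -- The gap s = b^(e+2) - f exceeds 1 because adding 1 misses the power, and s ≤ m = b - 1
    -- because adding m reaches it.
    ... | s , f+s≡ = inj₂ (gap⇒SpecialNumber {k} {i = e}
      (+-cancelˡ-< f 1 s (subst (f + 1 <_) (sym f+s≡) missed))
      (s≤s (+-cancelˡ-≤ f s m (≤-trans (≤-reflexive f+s≡) carry)))
      f+s≡)

  -- Special numbers have no comma-child

  SpecialNumber⇒lastDigit≡y : ∀ {k i x y} → y < b →
    k + b * b ≡ b ^ (2 + i) + x * b + y → lastDigit b k ≡ y
  SpecialNumber⇒lastDigit≡y {k} {i} {x} {y} y<b val = begin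
    k % b                          ≡⟨ [m+kn]%n≡m%n k b b ⟨
    (k + b * b) % b                ≡⟨ cong (_% b) (trans val (solve b (b ^ suc i) x y)) ⟩
    (y + (b ^ suc i + x) * b) % b  ≡⟨ [m+kn]%n≡m%n y (b ^ suc i + x) b ⟩
    y % b                          ≡⟨ m<n⇒m%n≡m y<b ⟩
    y                              ∎
    where
    open ≡-Reasoning
    solve : ∀ b B x y → b * B + x * b + y ≡ y + (B + x) * b
    solve = solve-∀

  -- Such an n is one of the last b numbers below b^(e+2), and b ≤ b^(e+1) keeps these inside the
  -- interval of the top digit.
  Leads-b∸1 : ∀ {n e r} → r < b → n + b ≡ b ^ (2 + e) + r → Leads n (b ∸ 1)
  Leads-b∸1 {n} {e} {r} r<b eq = suc e , lo , hi
    where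
    open ≤-Reasoning
    n′ = b ∸ 1
    lo : n′ * b ^ suc e ≤ n
    lo = +-cancelʳ-≤ b _ _ (begin
      n′ * b ^ suc e + b          ≤⟨ +-monoʳ-≤ (n′ * b ^ suc e) (b≤b^suc e) ⟩
      n′ * b ^ suc e + b ^ suc e  ≡⟨ +-comm _ (b ^ suc e) ⟩
      suc n′ * b ^ suc e          ≡⟨ cong (_* b ^ suc e) suc[b∸1]≡b ⟩
      b ^ (2 + e)                 ≤⟨ m≤m+n _ r ⟩
      b ^ (2 + e) + r             ≡⟨ eq ⟨
      n + b                       ∎)
    hi : n < suc n′ * b ^ suc e
    hi = +-cancelʳ-< b _ _ (begin-strict
      n + b                   ≡⟨ eq ⟩
      b ^ (2 + e) + r         <⟨ +-monoʳ-< (b ^ (2 + e)) r<b ⟩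
      b ^ (2 + e) + b         ≡⟨ cong (λ m → m * b ^ suc e + b) suc[b∸1]≡b ⟨
      suc n′ * b ^ suc e + b  ∎)

  -- Such an n is one of the first b numbers from B = b^(e+2) on, and B + b ≤ 2 B.
  Leads-1 : ∀ {n e r} → b ≤ r → r < b + b → n + b ≡ b ^ (2 + e) + r → Leads n 1
  Leads-1 {n} {e} {r} b≤r r<2b eq = 2 + e , lo , hi
    where
    open ≤-Reasoning
    B = b ^ (2 + e)
    lo : 1 * B ≤ n
    lo = +-cancelʳ-≤ b _ _ (begin
      1 * B + b  ≡⟨ cong (_+ b) (*-identityˡ B) ⟩
      B + b      ≤⟨ +-monoʳ-≤ B b≤r ⟩
      B + r      ≡⟨ eq ⟨
      n + b      ∎)
    hi : n < 2 * B
    hi = +-cancelʳ-< b _ _ (begin-strict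
      n + b          ≡⟨ eq ⟩
      B + r          <⟨ +-monoʳ-< B r<2b ⟩
      B + (b + b)    ≤⟨ +-monoʳ-≤ B (+-monoˡ-≤ b (b≤b^suc (suc e))) ⟩
      B + (B + b)    ≡⟨ +-assoc B B b ⟨
      B + B + b      ≡⟨ cong (λ m → B + m + b) (*-identityˡ B) ⟨
      2 * B + b      ∎)

  SpecialNumber⇒¬CommaChild : ∀ {k} → SpecialNumber k → ¬ ∃ (CommaChild b k)
  SpecialNumber⇒¬CommaChild {k} (i , x , y , 1≤x , 1≤y , 1+x+y≡b , val)
    (k′ , _ , c , leadingDigit , diff) = absurd (LeadingDigit⇒Leads c leadingDigit)
    where
    c′ = toℕ c
    y<b : y < b
    y<b = subst (y <_) 1+x+y≡b (s≤s (m≤n+m y x))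
    k′≡ : k′ ≡ k + (y * b + c′)
    k′≡ = trans (+m-+n≡+o⇒m≡n+o k′ k _ diff)
      (cong (λ d → k + (d * b + c′)) (SpecialNumber⇒lastDigit≡y {i = i} {x} y<b val))
    k′+b≡ : k′ + b ≡ b ^ (2 + i) + (y + c′)
    -- Adding x b to both sides collects (1 + x + y) b = b², so that `val` applies.
    k′+b≡ = +-cancelʳ-≡ (x * b) _ _ (begin
      k′ + b + x * b
        ≡⟨ cong (λ n → n + b + x * b) k′≡ ⟩
      k + (y * b + c′) + b + x * b
        ≡⟨ solve₂ k y c′ b x ⟩
      k + suc (x + y) * b + c′
        ≡⟨ cong (λ n → k + n * b + c′) 1+x+y≡b ⟩
      k + b * b + c′
        ≡⟨ cong (_+ c′) val ⟩
      b ^ (2 + i) + x * b + y + c′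
        ≡⟨ solve₃ (b ^ (2 + i)) (x * b) y c′ ⟩
      b ^ (2 + i) + (y + c′) + x * b
        ∎)
      where
      open ≡-Reasoning
      solve₂ : ∀ k y c b x → k + (y * b + c) + b + x * b ≡ k + suc (x + y) * b + c
      solve₂ = solve-∀
      solve₃ : ∀ B X y c → B + X + y + c ≡ B + (y + c) + X
      solve₃ = solve-∀
    absurd : 1 ≤ c′ × Leads k′ c′ → ⊥
    absurd (1≤c , leads) with <-≤-connex (y + c′) b
    -- Here k′ is still below the power, so c = b - 1; but then 1 ≤ y gives y + c ≥ b.
    ... | inj₁ y+c<b = <⇒≱ y+c<b (begin
      b            ≡⟨ suc[b∸1]≡b ⟨
      1 + (b ∸ 1)  ≤⟨ +-monoˡ-≤ (b ∸ 1) 1≤y ⟩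
      y + (b ∸ 1)  ≡⟨ cong (λ m → y + m) c≡b-1 ⟨
      y + c′       ∎)
      where
      open ≤-Reasoning
      c≡b-1 : c′ ≡ b ∸ 1
      c≡b-1 = Leads-unique 1≤c (toℕ<n c) (m<n⇒0<n∸m 1<b) (≤-reflexive suc[b∸1]≡b)
        leads (Leads-b∸1 {e = i} y+c<b k′+b≡)
    -- Here k′ has reached the power, so c = 1; but then 1 ≤ x gives y + c ≤ x + y < b.
    ... | inj₂ b≤y+c = <⇒≱ (begin-strict
      y + c′       ≡⟨ cong (λ m → y + m) c≡1 ⟩
      y + 1        ≤⟨ +-monoʳ-≤ y 1≤x ⟩
      y + x        ≡⟨ +-comm y x ⟩
      x + y        <⟨ ≤-reflexive 1+x+y≡b ⟩
      b            ∎) b≤y+c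
      where
      open ≤-Reasoning
      c≡1 : c′ ≡ 1
      c≡1 = Leads-unique 1≤c (toℕ<n c) ≤-refl 1<b
        leads (Leads-1 {e = i} b≤y+c (+-mono-< y<b (toℕ<n c)) k′+b≡)

  ¬CommaChild⇒SpecialForm : ∀ k .{{_ : NonZero k}} → ¬ ∃ (CommaChild b k) → SpecialForm b k
  ¬CommaChild⇒SpecialForm k noChild with CommaChild⊎SpecialNumber k
  ... | inj₁ child   = contradiction child noChild
  ... | inj₂ special = SpecialNumber⇒SpecialForm special

theorem5p1 : (b : ℕ) .{{_ : NonTrivial b}} (k : ℕ) .{{_ : NonZero k}} →
    ((¬ ∃ (CommaSuccessor b k)) ⇔ SpecialForm b k) ×
    ((¬ ∃ (CommaChild b k)) ⇔ SpecialForm b k)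
theorem5p1 b k =
  mk⇔ (¬CommaChild⇒SpecialForm k ∘ ¬∃-least⇒¬∃ (CommaChild b k))
      (λ special (k′ , child , _) → special⇒noChild special (k′ , child)) ,
  mk⇔ (¬CommaChild⇒SpecialForm k) special⇒noChild
  where
  special⇒noChild : SpecialForm b k → ¬ ∃ (CommaChild b k)
  special⇒noChild = SpecialNumber⇒¬CommaChild ∘ SpecialForm⇒SpecialNumber
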